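{- Let $p$ be a prime, $k\ge 1$, $q=p^k$, and $n\ge 1$. Then for every integer $i$ with $1\le i\le kn$, we have $p^{kn-i}\in\sigma\big(\mathrm{AGL}(n,q)\big)$.
   Context: For a finite group $G$ and a subgroup $H\le G$, a subset $\mathcal F\subseteq G$ is called $H$-intersecting if for all $g,g'\in\mathcal F$ there is $x\in G$ with $gxH=g'xH$ (equivalently $x^{ -1}g'^{ -1}gx\in H$). The intersection density is $\rho(G,H)=\max\{|\mathcal F|/|H| : \mathcal F\subseteq G \text{ is } H\text{ -intersecting}\}$, and the intersection spectrum of $G$ is $\sigma(G)=\{\rho(G,H): H\le G\}$. $\mathrm{AGL}(n,q)$ is the group of affine maps $v\mapsto Av+b$ of $\mathbb F_q^n$ with $A\in\mathrm{GL}(n,q)$, $b\in\mathbb F_q^n$, written as pairs $(A,b)$ with product $(A,b)(A',b')=(AA',Ab'+b)$. -}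

module Defs where

open import Algebra.Apartness.Bundles using (HeytingCommutativeRing; HeytingField)
open import Algebra.Bundles using (CommutativeRing; Group)
import Algebra.Definitions as AlgDef
import Algebra.Properties.Semiring.Sum as SemiringSum
open import Data.Bool.Base using (if_then_else_)
open import Data.Fin.Base using (Fin; zero; suc)
open import Data.Fin.Properties using (_≟_)
open import Data.Integer.Base using (+_)
open import Data.Nat.Base using (ℕ; NonZero)
open import Data.Product.Base using (Σ-syntax; ∃-syntax; _×_; _,_; proj₁; proj₂)
open import Data.Rational.Base as ℚ using (ℚ)
open import Data.Vec.Functional using (Vector)
import Data.Vec.Functional.Relation.Binary.Equality.Setoid as VecEq
open import Level using (Level; _⊔_) renaming (suc to lsuc)
open import Function.Bundles using (Inverse)
open import Relation.Binary.Bundles using (Setoid)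
import Relation.Binary.Construct.On as On
open import Relation.Binary.Definitions using (_Respects_)
open import Relation.Binary.PropositionalEquality.Core using (_≡_)
open import Relation.Binary.PropositionalEquality.Properties using (setoid)
import Relation.Binary.Reasoning.Setoid as SetoidReasoning
open import Relation.Nullary.Decidable.Core using (does)
open import Relation.Unary using (Pred; _∈_; _≐_)

-- m is the number of elements of S, counted up to its equality.
HasCardinality : ∀ {a ℓ} → Setoid a ℓ → ℕ → Set (a ⊔ ℓ)
HasCardinality S m = Inverse (setoid (Fin m)) S

SubsetHasCardinality : ∀ {a ℓ p} (S : Setoid a ℓ) → Pred (Setoid.Carrier S) p →
                       ℕ → Set (a ⊔ ℓ ⊔ p)
SubsetHasCardinality S P = HasCardinality (On.setoid S (proj₁ {B = P}))

IsMaximum : ∀ {p} → Pred ℚ p → ℚ → Set p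
IsMaximum P r = r ∈ P × (∀ s → s ∈ P → s ℚ.≤ r)

module _ {c ℓ : Level} (G : Group c ℓ) where
  open Group G

  record IsSubgroup (H : Pred Carrier ℓ) : Set (c ⊔ ℓ) where
    field
      resp      : H Respects _≈_
      ε-closed  : ε ∈ H
      ∙-closed  : ∀ {x y} → x ∈ H → y ∈ H → x ∙ y ∈ H
      ⁻¹-closed : ∀ {x} → x ∈ H → x ⁻¹ ∈ H

  LeftCoset : Carrier → Pred Carrier ℓ → Pred Carrier (c ⊔ ℓ)
  LeftCoset g H y = ∃[ h ] h ∈ H × y ≈ g ∙ h

  IsIntersecting : Pred Carrier ℓ → Pred Carrier ℓ → Set (c ⊔ ℓ)
  IsIntersecting H F = ∀ {g g′} → g ∈ F → g′ ∈ F →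
    ∃[ x ] LeftCoset (g ∙ x) H ≐ LeftCoset (g′ ∙ x) H

  -- The set of all ratios |F| / |H|, for F an H-intersecting subset of G.
  -- NonZero h excludes nothing when H is a subgroup, since ε ∈ H.
  IntersectingRatio : Pred Carrier ℓ → Pred ℚ (c ⊔ lsuc ℓ)
  IntersectingRatio H r =
    Σ[ F ∈ Pred Carrier ℓ ] F Respects _≈_ × IsIntersecting H F ×
    Σ[ f ∈ ℕ ] SubsetHasCardinality (Group.setoid G) F f ×
    Σ[ h ∈ ℕ ] SubsetHasCardinality (Group.setoid G) H h ×
    Σ[ h≢0 ∈ NonZero h ] r ≡ ℚ._/_ (+ f) h {{h≢0}}

  -- r = ρ(G,H).  A relation rather than a function, because a maximum over
  -- arbitrary predicates cannot be computed constructively.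
  IsIntersectionDensity : Pred Carrier ℓ → ℚ → Set (c ⊔ lsuc ℓ)
  IsIntersectionDensity H = IsMaximum (IntersectingRatio H)

  -- σ(G), as a set of rationals; meant for finite G.
  IntersectionSpectrum : Pred ℚ (c ⊔ lsuc ℓ)
  IntersectionSpectrum r =
    Σ[ H ∈ Pred Carrier ℓ ] IsSubgroup H × IsIntersectionDensity H r

module Matrices {c ℓ : Level} (R : CommutativeRing c ℓ) (n : ℕ) where
  open CommutativeRing R hiding (zero)
  open SemiringSum semiring using
    (sum; sum-cong-≋; ∑-distrib-+; ∑-comm; *-distribˡ-sum; *-distribʳ-sum; sum-replicate-zero)

  Vec : Set c
  Vec = Vector Carrier n

  Matrix : Set c
  Matrix = Vector Vec n

  vecSetoid : Setoid c ℓ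
  vecSetoid = VecEq.≋-setoid (CommutativeRing.setoid R) n

  matrixSetoid : Setoid c ℓ
  matrixSetoid = VecEq.≋-setoid vecSetoid n

  open Setoid vecSetoid public using () renaming (_≈_ to _≈ᵥ_)
  open Setoid matrixSetoid public using () renaming (_≈_ to _≈ₘ_)

  infixl 6 _+ᵥ_
  infixr 7 _*ᵥ_
  infixl 7 _*ₘ_
  infix  8 -ᵥ_

  _+ᵥ_ : Vec → Vec → Vec
  (v +ᵥ w) i = v i + w i

  -ᵥ_ : Vec → Vec
  (-ᵥ v) i = - v i

  0ᵥ : Vec
  0ᵥ _ = 0#

  _*ᵥ_ : Matrix → Vec → Vec
  (A *ᵥ v) i = sum (λ j → A i j * v j)

  _*ₘ_ : Matrix → Matrix → Matrix
  (A *ₘ B) i k = sum (λ j → A i j * B j k)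

  δ : ∀ {m} → Fin m → Fin m → Carrier
  δ i j = if does (i ≟ j) then 1# else 0#

  1ₘ : Matrix
  1ₘ = δ

  IsInvertible : Matrix → Set (c ⊔ ℓ)
  IsInvertible = AlgDef.Invertible _≈ₘ_ 1ₘ _*ₘ_

  private
    module Rng = SetoidReasoning (CommutativeRing.setoid R)
    module V = Setoid vecSetoid
    module M = Setoid matrixSetoid

    sum-zero : ∀ {m} (v : Vector Carrier m) → (∀ j → v j ≈ 0#) → sum v ≈ 0#
    sum-zero {m} v v≈0 = trans (sum-cong-≋ v≈0) (sum-replicate-zero m)

    sum-δ : ∀ {m} (i : Fin m) (v : Vector Carrier m) → sum (λ j → δ i j * v j) ≈ v i
    sum-δ zero v = begin
      1# * v zero + sum (λ j → 0# * v (suc j))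
        ≈⟨ +-cong (*-identityˡ _) (sum-zero (λ j → 0# * v (suc j)) (λ _ → zeroˡ _)) ⟩
      v zero + 0#  ≈⟨ +-identityʳ _ ⟩
      v zero       ∎
      where open Rng
    sum-δ (suc i) v = begin
      0# * v zero + sum (λ j → δ i j * v (suc j))
        ≈⟨ +-cong (zeroˡ _) (sum-δ i (λ j → v (suc j))) ⟩
      0# + v (suc i)  ≈⟨ +-identityˡ _ ⟩
      v (suc i)       ∎
      where open Rng

    δ-sym : ∀ {m} (i j : Fin m) → δ i j ≈ δ j i
    δ-sym zero    zero    = refl
    δ-sym zero    (suc j) = refl
    δ-sym (suc i) zero    = refl
    δ-sym (suc i) (suc j) = δ-sym i j

  *ᵥ-cong : ∀ {A B v w} → A ≈ₘ B → v ≈ᵥ w → A *ᵥ v ≈ᵥ B *ᵥ w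
  *ᵥ-cong A≈B v≈w i = sum-cong-≋ (λ j → *-cong (A≈B i j) (v≈w j))

  *ᵥ-identity : ∀ v → 1ₘ *ᵥ v ≈ᵥ v
  *ᵥ-identity v i = sum-δ i v

  *ᵥ-assoc : ∀ A B v → (A *ₘ B) *ᵥ v ≈ᵥ A *ᵥ (B *ᵥ v)
  *ᵥ-assoc A B v i = begin
    sum (λ k → sum (λ j → A i j * B j k) * v k)
      ≈⟨ sum-cong-≋ (λ k → *-distribʳ-sum (v k) (λ j → A i j * B j k)) ⟩
    sum (λ k → sum (λ j → A i j * B j k * v k))
      ≈⟨ ∑-comm (λ k j → A i j * B j k * v k) ⟩
    sum (λ j → sum (λ k → A i j * B j k * v k))
      ≈⟨ sum-cong-≋ (λ j → sum-cong-≋ (λ k → *-assoc (A i j) (B j k) (v k))) ⟩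
    sum (λ j → sum (λ k → A i j * (B j k * v k)))
      ≈⟨ sum-cong-≋ (λ j → *-distribˡ-sum (A i j) (λ k → B j k * v k)) ⟨
    sum (λ j → A i j * sum (λ k → B j k * v k)) ∎
    where open Rng

  *ᵥ-distribˡ : ∀ A v w → A *ᵥ (v +ᵥ w) ≈ᵥ A *ᵥ v +ᵥ A *ᵥ w
  *ᵥ-distribˡ A v w i = trans
    (sum-cong-≋ (λ j → distribˡ (A i j) (v j) (w j)))
    (∑-distrib-+ (λ j → A i j * v j) (λ j → A i j * w j))

  *ᵥ-zeroʳ : ∀ A → A *ᵥ 0ᵥ ≈ᵥ 0ᵥ
  *ᵥ-zeroʳ A i = sum-zero (λ j → A i j * 0#) (λ j → zeroʳ (A i j))

  *ₘ-cong : ∀ {A A′ B B′} → A ≈ₘ A′ → B ≈ₘ B′ → A *ₘ B ≈ₘ A′ *ₘ B′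
  *ₘ-cong A≈A′ B≈B′ i k = sum-cong-≋ (λ j → *-cong (A≈A′ i j) (B≈B′ j k))

  *ₘ-assoc : ∀ A B C → (A *ₘ B) *ₘ C ≈ₘ A *ₘ (B *ₘ C)
  *ₘ-assoc A B C i k = *ᵥ-assoc A B (λ j → C j k) i

  *ₘ-identityˡ : ∀ A → 1ₘ *ₘ A ≈ₘ A
  *ₘ-identityˡ A i k = sum-δ i (λ j → A j k)

  *ₘ-identityʳ : ∀ A → A *ₘ 1ₘ ≈ₘ A
  *ₘ-identityʳ A i k = trans
    (sum-cong-≋ (λ j → trans (*-comm _ _) (*-congʳ (δ-sym j k))))
    (sum-δ k (A i))

  private
    1ₘ-invertible : IsInvertible 1ₘ
    1ₘ-invertible = 1ₘ , *ₘ-identityˡ 1ₘ , *ₘ-identityˡ 1ₘ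

    cancel-inner : ∀ {A B C D} → B *ₘ C ≈ₘ 1ₘ → A *ₘ D ≈ₘ 1ₘ →
                   (A *ₘ B) *ₘ (C *ₘ D) ≈ₘ 1ₘ
    cancel-inner {A} {B} {C} {D} BC≈1 AD≈1 = begin
      (A *ₘ B) *ₘ (C *ₘ D)  ≈⟨ *ₘ-assoc A B (C *ₘ D) ⟩
      A *ₘ (B *ₘ (C *ₘ D))  ≈⟨ *ₘ-cong {A} M.refl (*ₘ-assoc B C D) ⟨
      A *ₘ ((B *ₘ C) *ₘ D)  ≈⟨ *ₘ-cong {A} M.refl (*ₘ-cong {B = D} BC≈1 M.refl) ⟩
      A *ₘ (1ₘ *ₘ D)        ≈⟨ *ₘ-cong {A} M.refl (*ₘ-identityˡ D) ⟩
      A *ₘ D                ≈⟨ AD≈1 ⟩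
      1ₘ                    ∎
      where open SetoidReasoning matrixSetoid

    *ₘ-invertible : ∀ {A B} → IsInvertible A → IsInvertible B → IsInvertible (A *ₘ B)
    *ₘ-invertible {A} {B} (A⁻¹ , A⁻¹A≈1 , AA⁻¹≈1) (B⁻¹ , B⁻¹B≈1 , BB⁻¹≈1) =
      B⁻¹ *ₘ A⁻¹ ,
      cancel-inner {B⁻¹} {A⁻¹} {A} {B} A⁻¹A≈1 B⁻¹B≈1 ,
      cancel-inner {A} {B} {B⁻¹} {A⁻¹} BB⁻¹≈1 AA⁻¹≈1

  -- The pair (linear , translation) stands for v ↦ linear *ᵥ v +ᵥ translation.
  record Affine : Set (c ⊔ ℓ) where
    constructor affine
    field
      linear      : Matrix
      invertible  : IsInvertible linear
      translation : Vec

    inverse : Matrix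
    inverse = proj₁ invertible

  open Affine

  infix  4 _≈ₐ_
  infixr 4 _,ₐ_

  -- The chosen inverse matrix plays no role in equality.
  record _≈ₐ_ (x y : Affine) : Set ℓ where
    constructor _,ₐ_
    field
      linear-≈      : linear x ≈ₘ linear y
      translation-≈ : translation x ≈ᵥ translation y

  affineSetoid : Setoid (c ⊔ ℓ) ℓ
  affineSetoid = record
    { Carrier       = Affine
    ; _≈_           = _≈ₐ_
    ; isEquivalence = record
      { refl  = λ {x} → M.refl {linear x} ,ₐ V.refl {translation x}
      ; sym   = λ (p ,ₐ q) → M.sym p ,ₐ V.sym q
      ; trans = λ (p ,ₐ q) (p′ ,ₐ q′) → M.trans p p′ ,ₐ V.trans q q′
      }
    }

  infixl 7 _∘ₐ_

  _∘ₐ_ : Affine → Affine → Affine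
  affine A A-inv b ∘ₐ affine A′ A′-inv b′ =
    affine (A *ₘ A′) (*ₘ-invertible A-inv A′-inv) (A *ᵥ b′ +ᵥ b)

  idₐ : Affine
  idₐ = affine 1ₘ 1ₘ-invertible 0ᵥ

  _⁻¹ₐ : Affine → Affine
  affine A (A⁻¹ , l , r) b ⁻¹ₐ = affine A⁻¹ (A , r , l) (A⁻¹ *ᵥ (-ᵥ b))

  private
    ∘ₐ-cong : ∀ {x x′ y y′} → x ≈ₐ x′ → y ≈ₐ y′ → x ∘ₐ y ≈ₐ x′ ∘ₐ y′
    ∘ₐ-cong (A≈ ,ₐ b≈) (A′≈ ,ₐ b′≈) =
      *ₘ-cong A≈ A′≈ ,ₐ λ i → +-cong (*ᵥ-cong A≈ b′≈ i) (b≈ i)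

    ∘ₐ-assoc : ∀ x y z → (x ∘ₐ y) ∘ₐ z ≈ₐ x ∘ₐ (y ∘ₐ z)
    ∘ₐ-assoc (affine A _ a) (affine B _ b) (affine C _ v) = *ₘ-assoc A B C ,ₐ λ i → begin
      ((A *ₘ B) *ᵥ v) i + ((A *ᵥ b) i + a i)  ≈⟨ +-assoc _ _ _ ⟨
      ((A *ₘ B) *ᵥ v) i + (A *ᵥ b) i + a i    ≈⟨ +-congʳ (+-congʳ (*ᵥ-assoc A B v i)) ⟩
      (A *ᵥ (B *ᵥ v)) i + (A *ᵥ b) i + a i    ≈⟨ +-congʳ (*ᵥ-distribˡ A (B *ᵥ v) b i) ⟨
      (A *ᵥ (B *ᵥ v +ᵥ b)) i + a i            ∎
      where open Rng

    ∘ₐ-identityˡ : ∀ x → idₐ ∘ₐ x ≈ₐ x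
    ∘ₐ-identityˡ (affine A _ b) =
      *ₘ-identityˡ A ,ₐ λ i → trans (+-identityʳ _) (*ᵥ-identity b i)

    ∘ₐ-identityʳ : ∀ x → x ∘ₐ idₐ ≈ₐ x
    ∘ₐ-identityʳ (affine A _ b) =
      *ₘ-identityʳ A ,ₐ λ i → trans (+-congʳ (*ᵥ-zeroʳ A i)) (+-identityˡ _)

    ∘ₐ-inverseˡ : ∀ x → x ⁻¹ₐ ∘ₐ x ≈ₐ idₐ
    ∘ₐ-inverseˡ (affine A (A⁻¹ , l , r) b) = l ,ₐ λ i → begin
      (A⁻¹ *ᵥ b) i + (A⁻¹ *ᵥ (-ᵥ b)) i  ≈⟨ *ᵥ-distribˡ A⁻¹ b (-ᵥ b) i ⟨
      (A⁻¹ *ᵥ (b +ᵥ -ᵥ b)) i            ≈⟨ *ᵥ-cong {A⁻¹} M.refl (λ j → -‿inverseʳ (b j)) i ⟩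
      (A⁻¹ *ᵥ 0ᵥ) i                     ≈⟨ *ᵥ-zeroʳ A⁻¹ i ⟩
      0#                                ∎
      where open Rng

    ∘ₐ-inverseʳ : ∀ x → x ∘ₐ x ⁻¹ₐ ≈ₐ idₐ
    ∘ₐ-inverseʳ (affine A (A⁻¹ , l , r) b) = r ,ₐ λ i → begin
      (A *ᵥ (A⁻¹ *ᵥ (-ᵥ b))) i + b i   ≈⟨ +-congʳ (*ᵥ-assoc A A⁻¹ (-ᵥ b) i) ⟨
      ((A *ₘ A⁻¹) *ᵥ (-ᵥ b)) i + b i   ≈⟨ +-congʳ (*ᵥ-cong {v = -ᵥ b} r V.refl i) ⟩
      (1ₘ *ᵥ (-ᵥ b)) i + b i           ≈⟨ +-congʳ (*ᵥ-identity (-ᵥ b) i) ⟩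
      - b i + b i                      ≈⟨ -‿inverseˡ (b i) ⟩
      0#                               ∎
      where open Rng

    ⁻¹ₐ-cong : ∀ {x y} → x ≈ₐ y → x ⁻¹ₐ ≈ₐ y ⁻¹ₐ
    ⁻¹ₐ-cong {x} {y} x≈y = begin
      x ⁻¹ₐ                   ≈⟨ ∘ₐ-identityʳ (x ⁻¹ₐ) ⟨
      x ⁻¹ₐ ∘ₐ idₐ            ≈⟨ ∘ₐ-cong A.refl (∘ₐ-inverseʳ y) ⟨
      x ⁻¹ₐ ∘ₐ (y ∘ₐ y ⁻¹ₐ)   ≈⟨ ∘ₐ-assoc (x ⁻¹ₐ) y (y ⁻¹ₐ) ⟨
      x ⁻¹ₐ ∘ₐ y ∘ₐ y ⁻¹ₐ     ≈⟨ ∘ₐ-cong (∘ₐ-cong A.refl x≈y) A.refl ⟨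
      x ⁻¹ₐ ∘ₐ x ∘ₐ y ⁻¹ₐ     ≈⟨ ∘ₐ-cong (∘ₐ-inverseˡ x) A.refl ⟩
      idₐ ∘ₐ y ⁻¹ₐ            ≈⟨ ∘ₐ-identityˡ (y ⁻¹ₐ) ⟩
      y ⁻¹ₐ                   ∎
      where
      open SetoidReasoning affineSetoid
      module A = Setoid affineSetoid

  affineGroup : Group (c ⊔ ℓ) ℓ
  affineGroup = record
    { Carrier = Affine
    ; _≈_     = _≈ₐ_
    ; _∙_     = _∘ₐ_
    ; ε       = idₐ
    ; _⁻¹     = _⁻¹ₐ
    ; isGroup = record
      { isMonoid = record
        { isSemigroup = record
          { isMagma = record
            { isEquivalence = Setoid.isEquivalence affineSetoid
            ; ∙-cong        = ∘ₐ-cong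
            }
          ; assoc = ∘ₐ-assoc
          }
        ; identity = ∘ₐ-identityˡ , ∘ₐ-identityʳ
        }
      ; inverse = ∘ₐ-inverseˡ , ∘ₐ-inverseʳ
      ; ⁻¹-cong = ⁻¹ₐ-cong
      }
    }

fieldSetoid : ∀ {c ℓ₁ ℓ₂} → HeytingField c ℓ₁ ℓ₂ → Setoid c ℓ₁
fieldSetoid 𝔽 = record { isEquivalence = HeytingField.isEquivalence 𝔽 }

-- A Heyting field with finitely many elements is a finite field in the usual
-- sense: its equality is then decidable, 0# ≉ 1# as _#_ is irreflexive, and
-- every x ≉ 0# has an inverse as _#_ is tight and inverses can be searched for.
AGL : ∀ {c ℓ₁ ℓ₂} → ℕ → HeytingField c ℓ₁ ℓ₂ → Group (c ⊔ ℓ₁) ℓ₁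
AGL n 𝔽 = Matrices.affineGroup commutativeRing n
  where open HeytingCommutativeRing (HeytingField.heytingCommutativeRing 𝔽)

{-# OPTIONS --safe #-}
module Submission where

-- Let H consist of the translations by a subgroup W of order pⁱ of the additive group
-- of 𝔽ⁿ; W exists because this group is elementary abelian of order pᵏⁿ.  If
-- g x H = g′ x H, then g′⁻¹ g is conjugate to a translation, so g and g′ have the same
-- linear part: an H-intersecting set has at most pᵏⁿ elements.  The group of all
-- translations attains this bound, since GL(n,q) is transitive on nonzero vectors and
-- W ≠ 0, so every translation is conjugate into H.  The density is therefore pᵏⁿ / pⁱ.

open import Defs
open import Algebra.Apartness.Bundles using (HeytingCommutativeRing; HeytingField)
open import Algebra.Bundles using (AbelianGroup; CommutativeRing; Group)
import Algebra.Construct.Pointwise as Pointwise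
import Algebra.Properties.CommutativeMonoid.Mult as CommutativeMonoidMult
import Algebra.Properties.CommutativeMonoid.Sum as CommutativeMonoidSum
import Algebra.Properties.CommutativeSemigroup as CommutativeSemigroupProperties
import Algebra.Properties.Group as GroupProperties
import Algebra.Properties.Monoid.Mult as MonoidMult
import Algebra.Properties.Ring as RingProperties
import Algebra.Properties.Semiring.Mult as SemiringMult
import Algebra.Properties.Semiring.Sum as SemiringSum
import Algebra.Solver.Ring.NaturalCoefficients.Default as SemiringSolver
open import Data.Fin.Base as Fin using (Fin; combine; finToFun; fromℕ<; funToFin; quotient; remainder; toℕ)
open import Data.Fin.Permutation using (Permutation; ↔⇒≡)
import Data.Fin.Properties as Fin
open import Data.Integer.Base as ℤ using (+_; +≤+)
import Data.Integer.Properties as ℤ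
open import Data.Nat.Base as ℕ using (ℕ; NonZero; suc; zero; _≤_; _<_; _^_; _∸_)
open import Data.Nat.Coprimality using (coprime-Bézout; prime⇒coprime)
open import Data.Nat.DivMod using (m%n<n; m≡m%n+[m/n]*n)
open import Data.Nat.GCD using (module Bézout)
open import Data.Nat.Primality using (Prime; prime⇒nonTrivial; prime⇒nonZero)
import Data.Nat.Properties as ℕ
open import Data.Product.Base using (∃-syntax; _×_; _,_; proj₁; proj₂)
open import Data.Rational.Base as ℚ using (_/_; fromℚᵘ; toℚᵘ)
import Data.Rational.Properties as ℚ
open import Data.Rational.Unnormalised.Base using (mkℚᵘ; *≡*; *≤*)
import Data.Rational.Unnormalised.Properties as ℚᵘ
open import Data.Sum.Base using (_⊎_; inj₁; inj₂)
open import Data.Unit.Polymorphic.Base using (⊤)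
open import Function.Base using (_∘_)
open import Function.Bundles using (Inverse)
import Function.Construct.Composition as Composition
import Function.Construct.Symmetry as Symmetry
open import Function.Properties.Inverse using (Inverse⇒Injection)
open import Level using (_⊔_)
open import Relation.Binary.Bundles using (Setoid)
open import Relation.Binary.Definitions using (Decidable; tri<; tri≈; tri>)
open import Relation.Binary.PropositionalEquality as ≡ using (_≡_)
import Relation.Binary.Reasoning.Setoid as SetoidReasoning
open import Relation.Nullary.Decidable using (via-injection)
open import Relation.Nullary.Decidable.Core using (yes; no)
open import Relation.Nullary.Negation using (¬_; contradiction)
open import Relation.Unary using (Pred; _∈_; _∉_; _≐_)

-- Finite setoids and their enumerations.

module _ {a ℓ} (S : Setoid a ℓ) where
  open Setoid S

  cardinality : ∀ {m} (e : Fin m → Carrier) → (∀ {i j} → e i ≈ e j → i ≡ j) →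
                (∀ x → ∃[ i ] e i ≈ x) → HasCardinality S m
  cardinality e e-injective e-surjective = record
    { to        = e
    ; from      = proj₁ ∘ e-surjective
    ; to-cong   = λ { ≡.refl → refl }
    ; from-cong = λ {x} {y} x≈y →
        e-injective (trans (proj₂ (e-surjective x)) (trans x≈y (sym (proj₂ (e-surjective y)))))
    ; inverse   = (λ { {x} ≡.refl → proj₂ (e-surjective x) }) ,
                  (λ {i} {x} x≈ei → e-injective (trans (proj₂ (e-surjective x)) x≈ei))
    }

  cardinality-unique : ∀ {m n} → HasCardinality S m → HasCardinality S n → m ≡ n
  cardinality-unique card card′ = ↔⇒≡ (Composition.inverse card (Symmetry.inverse card′))

module Enumeration {a ℓ} {S : Setoid a ℓ} {m : ℕ} (card : HasCardinality S m) where
  open Setoid S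
  open Inverse card public using () renaming (to to element; from to index; from-cong to index-cong)

  element-index : ∀ x → element (index x) ≈ x
  element-index = Inverse.strictlyInverseˡ card

  index-element : ∀ i → index (element i) ≡ i
  index-element = Inverse.strictlyInverseʳ card

  index-injective : ∀ {x y} → index x ≡ index y → x ≈ y
  index-injective {x} {y} eq =
    trans (sym (element-index x)) (trans (Inverse.to-cong card eq) (element-index y))

  element-injective : ∀ {i j} → element i ≈ element j → i ≡ j
  element-injective {i} {j} eq =
    ≡.trans (≡.sym (index-element i)) (≡.trans (index-cong eq) (index-element j))

  infix 4 _≈?_
  _≈?_ : Decidable _≈_
  _≈?_ = via-injection (Inverse⇒Injection (Symmetry.inverse card)) Fin._≟_

-- Finite abelian groups and their subgroups.

module AbelianGroupLemmas {c ℓ} (A : AbelianGroup c ℓ) where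
  open AbelianGroup A
  open GroupProperties group using (identityʳ-unique; inverseˡ-unique; ∙-cancelˡ)
  open CommutativeSemigroupProperties commutativeSemigroup using (interchange)
  open CommutativeMonoidMult commutativeMonoid renaming (_×_ to _⋆_)
  open CommutativeMonoidSum commutativeMonoid using (sum; sum-permute; sum-replicate; ∑-distrib-+; sum-cong-≋)
  open SetoidReasoning setoid

  -- Translating by x permutes the group, so it fixes the sum of all elements.
  ×-cardinality : ∀ {m} → HasCardinality setoid m → ∀ x → m ⋆ x ≈ ε
  ×-cardinality {m} card x = identityʳ-unique (sum element) (m ⋆ x) (begin
    sum element ∙ m ⋆ x                         ≈⟨ ∙-congˡ (sum-replicate m) ⟨
    sum element ∙ sum {m} (λ _ → x)             ≈⟨ ∑-distrib-+ element (λ _ → x) ⟨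
    sum (λ i → element i ∙ x)                   ≈⟨ sum-cong-≋ (λ i → element-index (element i ∙ x)) ⟨
    sum (λ i → element (index (element i ∙ x))) ≈⟨ sum-permute element translation ⟨
    sum element                                 ∎)
    where
    open Enumeration card

    shift : Inverse setoid setoid
    shift = record
      { to        = _∙ x
      ; from      = _∙ x ⁻¹
      ; to-cong   = ∙-congʳ
      ; from-cong = ∙-congʳ
      ; inverse   =
        (λ {y} {z} z≈ → trans (∙-congʳ z≈) (trans (assoc y _ _) (trans (∙-congˡ (inverseˡ x)) (identityʳ y)))) ,
        (λ {y} {z} z≈ → trans (∙-congʳ z≈) (trans (assoc y _ _) (trans (∙-congˡ (inverseʳ x)) (identityʳ y))))
      }

    translation : Permutation m m
    translation = Composition.inverse card (Composition.inverse shift (Symmetry.inverse card))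

  -- Encoded by an injective enumeration: the order is then carried by the type, and membership
  -- becomes a search over `Fin m`.
  record FiniteSubgroup (m : ℕ) : Set (c ⊔ ℓ) where
    field
      member           : Fin m → Carrier
      member-injective : ∀ {i j} → member i ≈ member j → i ≡ j

    Member : Pred Carrier ℓ
    Member x = ∃[ i ] x ≈ member i

    field
      ε-closed  : ε ∈ Member
      ∙-closed  : ∀ {x y} → x ∈ Member → y ∈ Member → x ∙ y ∈ Member
      ⁻¹-closed : ∀ {x} → x ∈ Member → x ⁻¹ ∈ Member

    resp : ∀ {x y} → x ≈ y → x ∈ Member → y ∈ Member
    resp x≈y (i , x≈i) = i , trans (sym x≈y) x≈i

    ×-closed : ∀ n {x} → x ∈ Member → n ⋆ x ∈ Member
    ×-closed zero    x∈ = ε-closed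
    ×-closed (suc n) x∈ = ∙-closed x∈ (×-closed n x∈)

  trivial : FiniteSubgroup 1
  trivial = record
    { member           = λ _ → ε
    ; member-injective = λ { {Fin.zero} {Fin.zero} _ → ≡.refl }
    ; ε-closed         = Fin.zero , refl
    ; ∙-closed         = λ (_ , x≈ε) (_ , y≈ε) → Fin.zero , trans (∙-cong x≈ε y≈ε) (identityˡ ε)
    ; ⁻¹-closed        = λ (_ , x≈ε) → Fin.zero , trans (⁻¹-cong x≈ε) (GroupProperties.ε⁻¹≈ε group)
    }

  -- Subgroups of every order in an elementary abelian `p`-group.

  module _ {p : ℕ} (p-prime : Prime p) (p×≈ε : ∀ x → p ⋆ x ≈ ε) where
    private instance
      p≢0 : NonZero p
      p≢0 = prime⇒nonZero p-prime

    p*×≈ε : ∀ n x → (n ℕ.* p) ⋆ x ≈ ε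
    p*×≈ε n x = begin
      (n ℕ.* p) ⋆ x  ≡⟨ ≡.cong (_⋆ x) (ℕ.*-comm n p) ⟩
      (p ℕ.* n) ⋆ x  ≈⟨ ×-assocˡ x p n ⟨
      p ⋆ (n ⋆ x)    ≈⟨ p×≈ε (n ⋆ x) ⟩
      ε              ∎

    ×-% : ∀ n x → n ⋆ x ≈ (n ℕ.% p) ⋆ x
    ×-% n x = begin
      n ⋆ x                                ≡⟨ ≡.cong (_⋆ x) (m≡m%n+[m/n]*n n p) ⟩
      (n ℕ.% p ℕ.+ n ℕ./ p ℕ.* p) ⋆ x      ≈⟨ ×-homo-+ x (n ℕ.% p) (n ℕ./ p ℕ.* p) ⟩
      (n ℕ.% p) ⋆ x ∙ (n ℕ./ p ℕ.* p) ⋆ x  ≈⟨ ∙-congˡ (p*×≈ε (n ℕ./ p) x) ⟩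
      (n ℕ.% p) ⋆ x ∙ ε                    ≈⟨ identityʳ _ ⟩
      (n ℕ.% p) ⋆ x                        ∎

    ⁻¹≈× : ∀ x → x ⁻¹ ≈ ℕ.pred p ⋆ x
    ⁻¹≈× x = sym (inverseˡ-unique _ x (begin
      ℕ.pred p ⋆ x ∙ x        ≈⟨ comm _ _ ⟩
      suc (ℕ.pred p) ⋆ x      ≡⟨ ≡.cong (_⋆ x) (ℕ.suc-pred p) ⟩
      p ⋆ x                   ≈⟨ p×≈ε x ⟩
      ε                       ∎))

    module _ {m} (U : FiniteSubgroup m) where
      open FiniteSubgroup U

      -- Bézout makes `n` invertible modulo `p`, and multiples of `p` vanish. So `x` is, up to sign,
      -- a multiple of `n ⋆ x`; the two cases are the two signs in the Bézout identity.
      ×∈⇒∈ : ∀ {n x} → 0 < n → n < p → n ⋆ x ∈ Member → x ∈ Member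
      ×∈⇒∈ {n} {x} 0<n n<p nx∈
        with coprime-Bézout (prime⇒coprime p-prime {{ℕ.>-nonZero 0<n}} n<p)
      ... | Bézout.+- a b eq = resp
              (trans (⁻¹-cong (×-assocˡ x b n)) (sym (inverseˡ-unique x ((b ℕ.* n) ⋆ x) (begin
                suc (b ℕ.* n) ⋆ x  ≡⟨ ≡.cong (_⋆ x) eq ⟩
                (a ℕ.* p) ⋆ x      ≈⟨ p*×≈ε a x ⟩
                ε                  ∎))))
              (⁻¹-closed (×-closed b nx∈))
      ... | Bézout.-+ a b eq = resp (begin
                b ⋆ (n ⋆ x)        ≈⟨ ×-assocˡ x b n ⟩
                (b ℕ.* n) ⋆ x      ≡⟨ ≡.cong (_⋆ x) eq ⟨
                x ∙ (a ℕ.* p) ⋆ x  ≈⟨ ∙-congˡ (p*×≈ε a x) ⟩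
                x ∙ ε              ≈⟨ identityʳ x ⟩
                x                  ∎)
              (×-closed b nx∈)

      -- The cosets of `U` through the multiples of `v` are disjoint: a coincidence would give
      -- `(k ∸ j) ⋆ v` = `x ∙ y ⁻¹` in `U`, and with it `v`.
      multiple-unique : ∀ {v} → v ∉ Member → ∀ {x y} → x ∈ Member → y ∈ Member →
                        ∀ {j k} → j < k → k < p → ¬ (j ⋆ v ∙ x ≈ k ⋆ v ∙ y)
      multiple-unique {v} v∉ {x} {y} x∈ y∈ {j} {k} j<k k<p eq = v∉
        (×∈⇒∈ (ℕ.m<n⇒0<n∸m j<k) (ℕ.≤-<-trans (ℕ.m∸n≤m k j) k<p)
          (resp difference (∙-closed x∈ (⁻¹-closed y∈))))
        where
        x≈ : x ≈ (k ∸ j) ⋆ v ∙ y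
        x≈ = ∙-cancelˡ (j ⋆ v) x _ (begin
          j ⋆ v ∙ x                   ≈⟨ eq ⟩
          k ⋆ v ∙ y                   ≡⟨ ≡.cong (λ l → l ⋆ v ∙ y) (ℕ.m+[n∸m]≡n (ℕ.<⇒≤ j<k)) ⟨
          (j ℕ.+ (k ∸ j)) ⋆ v ∙ y     ≈⟨ ∙-congʳ (×-homo-+ v j (k ∸ j)) ⟩
          j ⋆ v ∙ (k ∸ j) ⋆ v ∙ y     ≈⟨ assoc _ _ _ ⟩
          j ⋆ v ∙ ((k ∸ j) ⋆ v ∙ y)   ∎)

        difference : x ∙ y ⁻¹ ≈ (k ∸ j) ⋆ v
        difference = begin
          x ∙ y ⁻¹                    ≈⟨ ∙-congʳ x≈ ⟩
          (k ∸ j) ⋆ v ∙ y ∙ y ⁻¹      ≈⟨ assoc _ _ _ ⟩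
          (k ∸ j) ⋆ v ∙ (y ∙ y ⁻¹)    ≈⟨ ∙-congˡ (inverseʳ y) ⟩
          (k ∸ j) ⋆ v ∙ ε             ≈⟨ identityʳ _ ⟩
          (k ∸ j) ⋆ v                 ∎

      -- The subgroup generated by `U` and `v` is the union of `p` disjoint cosets of `U`; `combine`
      -- numbers the pairs of a multiplier below `p` and an element of `U`.
      adjoin : ∀ {v} → v ∉ Member → FiniteSubgroup (p ℕ.* m)
      adjoin {v} v∉ = record
        { member           = member′
        ; member-injective = λ {a} {b} → member′-injective {a} {b}
        ; ε-closed         = closed zero ε-closed (sym (identityˡ ε))
        ; ∙-closed         = λ (a , x≈) (b , y≈) →
            closed (toℕ (multiplier a) ℕ.+ toℕ (multiplier b))
              (∙-closed (base a , refl) (base b , refl))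
              (trans (∙-cong x≈ y≈) (trans (interchange _ _ _ _)
                (∙-congʳ (sym (×-homo-+ v (toℕ (multiplier a)) _)))))
        -- Inversion is multiplication by `p - 1`, so no negative multipliers are needed.
        ; ⁻¹-closed        = λ {x} (a , x≈) →
            closed (ℕ.pred p ℕ.* toℕ (multiplier a)) (×-closed (ℕ.pred p) (base a , refl)) (begin
              x ⁻¹                          ≈⟨ ⁻¹≈× x ⟩
              ℕ.pred p ⋆ x                  ≈⟨ ×-congʳ (ℕ.pred p) x≈ ⟩
              ℕ.pred p ⋆ (member′ a)        ≈⟨ ×-distrib-+ _ _ (ℕ.pred p) ⟩
              ℕ.pred p ⋆ (toℕ (multiplier a) ⋆ v) ∙ ℕ.pred p ⋆ member (base a)
                                            ≈⟨ ∙-congʳ (×-assocˡ v (ℕ.pred p) _) ⟩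
              (ℕ.pred p ℕ.* toℕ (multiplier a)) ⋆ v ∙ ℕ.pred p ⋆ member (base a) ∎)
        }
        where
        multiplier : Fin (p ℕ.* m) → Fin p
        multiplier = quotient m

        base : Fin (p ℕ.* m) → Fin m
        base = remainder {p} m

        member′ : Fin (p ℕ.* m) → Carrier
        member′ a = toℕ (multiplier a) ⋆ v ∙ member (base a)

        -- Admits an arbitrary multiplier `n` and reduces it modulo `p` once, so that sums and
        -- multiples of multipliers cause no overflow in the closure proofs.
        closed : ∀ {x y} n → y ∈ Member → x ≈ n ⋆ v ∙ y → ∃[ a ] x ≈ member′ a
        closed {x} {y} n (i , y≈) x≈ = combine n%p i , (begin
          x                         ≈⟨ x≈ ⟩
          n ⋆ v ∙ y                 ≈⟨ ∙-cong (×-% n v) y≈ ⟩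
          (n ℕ.% p) ⋆ v ∙ member i  ≡⟨ ≡.cong (λ l → l ⋆ v ∙ member i) (Fin.toℕ-fromℕ< (m%n<n n p)) ⟨
          toℕ n%p ⋆ v ∙ member i    ≡⟨ ≡.cong (λ (l , i) → toℕ l ⋆ v ∙ member i) (Fin.remQuot-combine n%p i) ⟨
          member′ (combine n%p i)   ∎)
          where n%p = fromℕ< (m%n<n n p)

        member′-injective : ∀ {a b} → member′ a ≈ member′ b → a ≡ b
        member′-injective {a} {b} eq with Fin.<-cmp (multiplier a) (multiplier b)
        ... | tri< j<k _ _ = contradiction eq
                (multiple-unique v∉ (base a , refl) (base b , refl) j<k (Fin.toℕ<n (multiplier b)))
        ... | tri> _ _ k<j = contradiction (sym eq)
                (multiple-unique v∉ (base b , refl) (base a , refl) k<j (Fin.toℕ<n (multiplier a)))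
        ... | tri≈ _ j≡k _ = ≡.trans (≡.sym (Fin.combine-remQuot {p} m a))
                (≡.trans (≡.cong₂ combine j≡k (member-injective
                  (∙-cancelˡ (toℕ (multiplier b) ⋆ v) _ _ (≡.subst (λ j → toℕ j ⋆ v ∙ member (base a) ≈ member′ b) j≡k eq))))
                  (Fin.combine-remQuot {p} m b))

    module _ {N} (card : HasCardinality setoid N) where
      open Enumeration card

      -- Pigeonhole: if every element were a member, taking member indices would inject `Fin N` into
      -- `Fin m`.
      outsider : ∀ {m} (U : FiniteSubgroup m) → m < N → ∃[ v ] v ∉ FiniteSubgroup.Member U
      outsider {m} U m<N = element (proj₁ outside) , proj₂ outside
        where
        open FiniteSubgroup U

        not-covering : ¬ (∀ i → element i ∈ Member)
        not-covering all∈ = ℕ.<⇒≱ m<N (Fin.injective⇒≤ {f = proj₁ ∘ all∈} λ {i} {j} eq →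
          element-injective (begin
            element i                  ≈⟨ proj₂ (all∈ i) ⟩
            member (proj₁ (all∈ i))    ≡⟨ ≡.cong member eq ⟩
            member (proj₁ (all∈ j))    ≈⟨ proj₂ (all∈ j) ⟨
            element j                  ∎))

        outside : ∃[ i ] element i ∉ Member
        -- Membership is decidable by search, so refuting the universal statement yields an actual
        -- element.
        outside = Fin.¬∀⟶∃¬ N (λ i → element i ∈ Member)
          (λ i → Fin.any? (λ j → element i ≈? member j)) not-covering

    -- As long as `i < r`, a subgroup of order `p ^ i` misses some element, and adjoining it
    -- multiplies the order by `p`.
    subgroup-of-order-^ : ∀ {r} → HasCardinality setoid (p ^ r) → ∀ i → i ≤ r → FiniteSubgroup (p ^ i)
    subgroup-of-order-^ card zero    i≤r = trivial
    subgroup-of-order-^ card (suc i) i<r = adjoin U (proj₂ (outsider card U (ℕ.^-monoʳ-< p 1<p i<r)))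
      where
      U : FiniteSubgroup (p ^ i)
      U = subgroup-of-order-^ card i (ℕ.<⇒≤ i<r)

      1<p : 1 < p
      1<p = ℕ.nonTrivial⇒n>1 p {{prime⇒nonTrivial p-prime}}

-- Transitivity of the general linear group on nonzero vectors.

module MatrixLemmas {c ℓ} (R : CommutativeRing c ℓ) (n : ℕ) where
  open CommutativeRing R
  open Matrices R n
  open SemiringSum semiring using (sum; sum-cong-≋; *-distribˡ-sum; *-distribʳ-sum; ∑-distrib-+)
  open SetoidReasoning setoid
  open SemiringSolver commutativeSemiring using (solve; _:+_; _:*_; _:=_)

  infix 8 _·_
  _·_ : Vec → Vec → Carrier
  φ · v = sum (λ j → φ j * v j)

  ·-distribʳ-+ : ∀ φ ψ v → (φ +ᵥ ψ) · v ≈ φ · v + ψ · v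
  ·-distribʳ-+ φ ψ v = trans (sum-cong-≋ (λ j → distribʳ (v j) (φ j) (ψ j)))
    (∑-distrib-+ (λ j → φ j * v j) (λ j → ψ j * v j))

  ·-distribˡ-+ : ∀ φ v w → φ · (v +ᵥ w) ≈ φ · v + φ · w
  ·-distribˡ-+ φ v w = trans (sum-cong-≋ (λ j → distribˡ (φ j) (v j) (w j)))
    (∑-distrib-+ (λ j → φ j * v j) (λ j → φ j * w j))

  ·-scaleʳ : ∀ φ s v → φ · (λ j → s * v j) ≈ s * φ · v
  ·-scaleʳ φ s v = trans
    (sum-cong-≋ (λ j → solve 3 (λ x s y → x :* (s :* y) := s :* (x :* y)) refl (φ j) s (v j)))
    (sym (*-distribˡ-sum s (λ j → φ j * v j)))

  ·-congˡ : ∀ φ {v w} → v ≈ᵥ w → φ · v ≈ φ · w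
  ·-congˡ φ v≈w = sum-cong-≋ (λ j → *-congˡ (v≈w j))

  module Transvections (d φ : Vec) where

    -- The rank-one perturbation v ↦ v + s (φ · v) d of the identity. Since `φ · d` may be nonzero,
    -- this covers dilations as well as transvections proper.
    transvection : Carrier → Matrix
    transvection s i j = δ i j + s * d i * φ j

    transvection-*ᵥ : ∀ s v i → (transvection s *ᵥ v) i ≈ v i + s * d i * φ · v
    transvection-*ᵥ s v i = begin
      sum (λ j → (δ i j + s * d i * φ j) * v j)
        ≈⟨ sum-cong-≋ (λ j → trans (distribʳ (v j) _ _) (+-congˡ (*-assoc (s * d i) (φ j) (v j)))) ⟩
      sum (λ j → δ i j * v j + s * d i * (φ j * v j))
        ≈⟨ ∑-distrib-+ (λ j → δ i j * v j) (λ j → s * d i * (φ j * v j)) ⟩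
      (1ₘ *ᵥ v) i + sum (λ j → s * d i * (φ j * v j))
        ≈⟨ +-cong (*ᵥ-identity v i) (sym (*-distribˡ-sum (s * d i) (λ j → φ j * v j))) ⟩
      v i + s * d i * φ · v ∎

    -- The product is again of this form, with coefficient `s + t + s * t * φ · d`; coefficient zero
    -- gives the identity.
    transvection-*ₘ : ∀ {s t} → s + t + s * t * φ · d ≈ 0# → transvection s *ₘ transvection t ≈ₘ 1ₘ
    transvection-*ₘ {s} {t} s∘t≈0 i k = begin
      (transvection s *ᵥ column) i
        ≈⟨ transvection-*ᵥ s column i ⟩
      δ i k + t * d i * φ k + s * d i * φ · column
        ≈⟨ +-congˡ (*-congˡ φ·column) ⟩
      δ i k + t * d i * φ k + s * d i * (φ k + φ k * t * φ · d)
        ≈⟨ solve 6 (λ x s t d f g → x :+ t :* d :* f :+ s :* d :* (f :+ f :* t :* g)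
                                  := x :+ (s :+ t :+ s :* t :* g) :* (d :* f))
                   refl (δ i k) s t (d i) (φ k) (φ · d) ⟩
      δ i k + (s + t + s * t * φ · d) * (d i * φ k)
        ≈⟨ +-congˡ (trans (*-congʳ s∘t≈0) (zeroˡ _)) ⟩
      δ i k + 0#
        ≈⟨ +-identityʳ _ ⟩
      δ i k ∎
      where
      column : Vec
      column j = transvection t j k

      φ·column : φ · column ≈ φ k + φ k * t * φ · d
      φ·column = begin
        φ · column
          ≈⟨ ·-distribˡ-+ φ (λ j → δ j k) (λ j → t * d j * φ k) ⟩
        φ · (λ j → δ j k) + φ · (λ j → t * d j * φ k)
          -- The first summand is an entry of the product of `1ₘ` with the matrix all of whose rows
          -- are `φ`.
          ≈⟨ +-cong (*ₘ-identityʳ (λ _ → φ) k k)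
               (·-congˡ φ (λ j → trans (*-comm _ _) (sym (*-assoc (φ k) t (d j))))) ⟩
        φ k + φ · (λ j → φ k * t * d j)
          ≈⟨ +-congˡ (·-scaleʳ φ (φ k * t) d) ⟩
        φ k + φ k * t * φ · d ∎

  -- With α = φ · u and β = φ · w, the map v ↦ v + α⁻¹ (φ · v) (w - u) sends u to w, and
  -- its inverse has the same form, with - β⁻¹ in place of α⁻¹.
  functional⇒transporter : ∀ φ {u w α⁻¹ β⁻¹} → φ · u * α⁻¹ ≈ 1# → φ · w * β⁻¹ ≈ 1# →
                           ∃[ A ] IsInvertible A × A *ᵥ u ≈ᵥ w
  functional⇒transporter φ {u} {w} {s} {β⁻¹} αs≈1 ββ⁻¹≈1 =
    transvection s ,
    (transvection t ,
     -- The condition is symmetric in `s` and `t`, so one computation gives both the left and the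
     -- right inverse.
     transvection-*ₘ (trans (+-cong (+-comm t s) (*-congʳ (*-comm t s))) s∘t≈0) ,
     transvection-*ₘ s∘t≈0) ,
    λ i → begin
      (transvection s *ᵥ u) i      ≈⟨ transvection-*ᵥ s u i ⟩
      u i + s * d i * φ · u        ≈⟨ +-congˡ (solve 3 (λ s d a → s :* d :* a := d :* (a :* s)) refl s (d i) (φ · u)) ⟩
      u i + d i * (φ · u * s)      ≈⟨ +-congˡ (trans (*-congˡ αs≈1) (*-identityʳ (d i))) ⟩
      u i + d i                    ≈⟨ u+d≈w i ⟩
      w i                          ∎
    where
    d : Vec
    d = w +ᵥ -ᵥ u

    t : Carrier
    t = - β⁻¹

    open Transvections d φ

    u+d≈w : u +ᵥ d ≈ᵥ w
    u+d≈w i = begin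
      u i + (w i + - u i)  ≈⟨ solve 3 (λ u w u′ → u :+ (w :+ u′) := w :+ (u :+ u′)) refl (u i) (w i) (- u i) ⟩
      w i + (u i + - u i)  ≈⟨ +-congˡ (-‿inverseʳ (u i)) ⟩
      w i + 0#             ≈⟨ +-identityʳ (w i) ⟩
      w i                  ∎

    -- Writing `t` as t (α s) turns the sum into s + s (α + φ · d) t. Here α + φ · d = β because
    -- `u +ᵥ d` is `w`, and β t = -1.
    s∘t≈0 : s + t + s * t * φ · d ≈ 0#
    s∘t≈0 = begin
      s + t + s * t * φ · d
        ≈⟨ +-congʳ (+-congˡ (trans (sym (*-identityʳ t)) (*-congˡ (sym αs≈1)))) ⟩
      s + t * (φ · u * s) + s * t * φ · d
        ≈⟨ solve 4 (λ s t a g → s :+ t :* (a :* s) :+ s :* t :* g := s :+ s :* ((a :+ g) :* t)) refl s t (φ · u) (φ · d) ⟩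
      s + s * ((φ · u + φ · d) * t)
        ≈⟨ +-congˡ (*-congˡ (*-congʳ (trans (sym (·-distribˡ-+ φ u d)) (·-congˡ φ u+d≈w)))) ⟩
      s + s * (φ · w * t)
        ≈⟨ +-congˡ (*-congˡ (trans (sym (RingProperties.-‿distribʳ-* ring (φ · w) β⁻¹)) (-‿cong ββ⁻¹≈1))) ⟩
      s + s * - 1#
        ≈⟨ +-congˡ (trans (*-comm s (- 1#)) (RingProperties.-1*x≈-x ring s)) ⟩
      s + - s
        ≈⟨ -‿inverseʳ s ⟩
      0# ∎

  module _ (zero-or-unit : ∀ x → x ≈ 0# ⊎ ∃[ y ] x * y ≈ 1#) where

    zero-or-unit-entry : ∀ {m} (v : Fin m → Carrier) →
                         (∀ i → v i ≈ 0#) ⊎ ∃[ i ] ∃[ y ] v i * y ≈ 1#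
    zero-or-unit-entry {zero}  v = inj₁ λ ()
    zero-or-unit-entry {suc m} v with zero-or-unit (v Fin.zero) | zero-or-unit-entry (λ i → v (Fin.suc i))
    ... | inj₂ unit | _                = inj₂ (Fin.zero , unit)
    ... | inj₁ v₀≈0 | inj₂ (i , unit) = inj₂ (Fin.suc i , unit)
    ... | inj₁ v₀≈0 | inj₁ v≈0        = inj₁ λ { Fin.zero → v₀≈0 ; (Fin.suc i) → v≈0 i }

    -- Some functional among the j-th coordinate, the l-th coordinate and their sum
    -- is nonzero on both vectors.
    transporter : ∀ {u w} → ¬ (u ≈ᵥ 0ᵥ) → ¬ (w ≈ᵥ 0ᵥ) → ∃[ A ] IsInvertible A × A *ᵥ u ≈ᵥ w
    transporter {u} {w} u≉0 w≉0 with zero-or-unit-entry u | zero-or-unit-entry w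
    ... | inj₁ u≈0 | _        = contradiction u≈0 u≉0
    ... | inj₂ _   | inj₁ w≈0 = contradiction w≈0 w≉0
    ... | inj₂ (j , y , uⱼy≈1) | inj₂ (l , z , wₗz≈1) with zero-or-unit (w j) | zero-or-unit (u l)
    ... | inj₂ (y′ , wⱼy′≈1) | _ = functional⇒transporter (δ j)
            (trans (*-congʳ (*ᵥ-identity u j)) uⱼy≈1) (trans (*-congʳ (*ᵥ-identity w j)) wⱼy′≈1)
    ... | inj₁ wⱼ≈0 | inj₂ (z′ , uₗz′≈1) = functional⇒transporter (δ l)
            (trans (*-congʳ (*ᵥ-identity u l)) uₗz′≈1) (trans (*-congʳ (*ᵥ-identity w l)) wₗz≈1)
    ... | inj₁ wⱼ≈0 | inj₁ uₗ≈0 = functional⇒transporter (δ j +ᵥ δ l)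
            (trans (*-congʳ (begin
              (δ j +ᵥ δ l) · u   ≈⟨ coordinates u ⟩
              u j + u l          ≈⟨ +-congˡ uₗ≈0 ⟩
              u j + 0#           ≈⟨ +-identityʳ (u j) ⟩
              u j                ∎)) uⱼy≈1)
            (trans (*-congʳ (begin
              (δ j +ᵥ δ l) · w   ≈⟨ coordinates w ⟩
              w j + w l          ≈⟨ +-congʳ wⱼ≈0 ⟩
              0# + w l           ≈⟨ +-identityˡ (w l) ⟩
              w l                ∎)) wₗz≈1)
      where
      coordinates : ∀ v → (δ j +ᵥ δ l) · v ≈ v j + v l
      coordinates v = trans (·-distribʳ-+ (δ j) (δ l) v) (+-cong (*ᵥ-identity v j) (*ᵥ-identity v l))

-- Comparing a fraction with an integer.

/1≡/ : ∀ f h m .{{_ : NonZero h}} → f ≡ m ℕ.* h → + m / 1 ≡ + f / h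
-- Once `h` is a successor, `+ f / h` is `fromℚᵘ` of an unnormalised fraction, which stores its
-- denominator minus one; cross-multiplication then avoids lowest terms.
/1≡/ f h@(suc h-1) m f≡m*h = ℚ.fromℚᵘ-cong {mkℚᵘ (+ m) 0} {mkℚᵘ (+ f) h-1}
  (*≡* (≡.trans (≡.sym (ℤ.pos-* m h)) (≡.trans (≡.cong +_ (≡.sym f≡m*h)) (≡.sym (ℤ.*-identityʳ (+ f))))))

/≤/1 : ∀ f h m .{{_ : NonZero h}} → f ≤ m ℕ.* h → + f / h ℚ.≤ + m / 1
/≤/1 f h@(suc h-1) m f≤m*h = ℚ.toℚᵘ-cancel-≤ (begin
  toℚᵘ (fromℚᵘ (mkℚᵘ (+ f) h-1))   ≃⟨ ℚ.toℚᵘ-fromℚᵘ (mkℚᵘ (+ f) h-1) ⟩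
  mkℚᵘ (+ f) h-1                   ≤⟨ *≤* (≡.subst₂ ℤ._≤_ (≡.sym (ℤ.*-identityʳ (+ f))) (ℤ.pos-* m h) (+≤+ f≤m*h)) ⟩
  mkℚᵘ (+ m) 0                     ≃⟨ ℚ.toℚᵘ-fromℚᵘ (mkℚᵘ (+ m) 0) ⟨
  toℚᵘ (fromℚᵘ (mkℚᵘ (+ m) 0))     ∎)
  where open ℚᵘ.≤-Reasoning

-- Left cosets.

module _ {c ℓ} (G : Group c ℓ) {H : Pred (Group.Carrier G) ℓ} (H-subgroup : IsSubgroup G H) where
  open Group G
  open IsSubgroup H-subgroup
  open SetoidReasoning setoid

  leftCoset-≐ : ∀ {x y h} → h ∈ H → x ≈ y ∙ h → LeftCoset G x H ≐ LeftCoset G y H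
  leftCoset-≐ {x} {y} {h} h∈H x≈yh =
    (λ {z} (k , k∈H , z≈xk) → h ∙ k , ∙-closed h∈H k∈H , (begin
      z            ≈⟨ z≈xk ⟩
      x ∙ k        ≈⟨ ∙-congʳ x≈yh ⟩
      y ∙ h ∙ k    ≈⟨ assoc y h k ⟩
      y ∙ (h ∙ k)  ∎)) ,
    (λ {z} (k , k∈H , z≈yk) → h ⁻¹ ∙ k , ∙-closed (⁻¹-closed h∈H) k∈H , (begin
      z                    ≈⟨ z≈yk ⟩
      y ∙ k                ≈⟨ ∙-congˡ (GroupProperties.\\-leftDividesˡ G h k) ⟨
      y ∙ (h ∙ (h ⁻¹ ∙ k)) ≈⟨ assoc y h _ ⟨
      y ∙ h ∙ (h ⁻¹ ∙ k)   ≈⟨ ∙-congʳ x≈yh ⟨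
      x ∙ (h ⁻¹ ∙ k)       ∎))

  ∈-leftCoset : ∀ x → x ∈ LeftCoset G x H
  ∈-leftCoset x = ε , ε-closed , sym (identityʳ x)

-- Finite fields: decidable invertibility and the characteristic.

module FiniteField {c ℓ₁ ℓ₂} (𝔽 : HeytingField c ℓ₁ ℓ₂) {q} (card : HasCardinality (fieldSetoid 𝔽) q) where
  open HeytingField 𝔽 using (tight; #⇒invertible)
  R : CommutativeRing c ℓ₁
  R = HeytingCommutativeRing.commutativeRing (HeytingField.heytingCommutativeRing 𝔽)
  open CommutativeRing R
  open Enumeration {S = setoid} card
  open SetoidReasoning setoid

  -- An inverse is searched for among the finitely many elements. If there is none, `x` is not apart
  -- from `0#`, and tightness gives `x ≈ 0#`.
  zero-or-unit : ∀ x → x ≈ 0# ⊎ ∃[ y ] x * y ≈ 1#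
  zero-or-unit x with Fin.any? (λ i → x * element i ≈? 1#)
  ... | yes (i , xy≈1) = inj₂ (element i , xy≈1)
  ... | no ¬unit = inj₁ (proj₁ (tight x 0#) λ x#0 →
          let y , _ , [x-0]y≈1 = #⇒invertible x#0 in
          ¬unit (index y , (begin
            x * element (index y)  ≈⟨ *-congˡ (element-index y) ⟩
            x * y                  ≈⟨ *-congʳ (x-0≈x) ⟨
            (x - 0#) * y           ≈⟨ [x-0]y≈1 ⟩
            1#                     ∎)))
    where
    x-0≈x : x - 0# ≈ x
    x-0≈x = trans (+-congˡ (GroupProperties.ε⁻¹≈ε +-group)) (+-identityʳ x)

  open SemiringMult semiring using (×-congʳ; ×-homo-1; ×-assoc-*; ×1-homo-*) renaming (_×_ to _⋆_)

  -- The order `p ^ k` of the additive group annihilates `1#`. In `root`, either `p ⋆ 1#` is zero or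
  -- it is a unit and one factor `p` cancels; cancelling all of them leaves `1#` equal to `0#`,
  -- where everything vanishes.
  characteristic : ∀ p k → q ≡ p ^ k → ∀ x → p ⋆ x ≈ 0#
  characteristic p k ≡.refl x = begin
    p ⋆ x         ≈⟨ ×-congʳ p (*-identityˡ x) ⟨
    p ⋆ (1# * x)  ≈⟨ ×-assoc-* p 1# x ⟨
    p ⋆ 1# * x    ≈⟨ *-congʳ (root k (AbelianGroupLemmas.×-cardinality +-abelianGroup card 1#)) ⟩
    0# * x        ≈⟨ zeroˡ x ⟩
    0#            ∎
    where
    root : ∀ k → (p ^ k) ⋆ 1# ≈ 0# → p ⋆ 1# ≈ 0#
    root zero    1≈0 = begin
      p ⋆ 1#       ≈⟨ *-identityʳ _ ⟨
      p ⋆ 1# * 1#  ≈⟨ *-congˡ (trans (sym (×-homo-1 1#)) 1≈0) ⟩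
      p ⋆ 1# * 0#  ≈⟨ zeroʳ _ ⟩
      0#           ∎
    root (suc k) p^[1+k]≈0 with zero-or-unit (p ⋆ 1#)
    ... | inj₁ p≈0        = p≈0
    ... | inj₂ (y , py≈1) = root k (begin
      (p ^ k) ⋆ 1#                  ≈⟨ *-identityˡ _ ⟨
      1# * (p ^ k) ⋆ 1#             ≈⟨ *-congʳ (trans (*-comm y _) py≈1) ⟨
      y * p ⋆ 1# * (p ^ k) ⋆ 1#     ≈⟨ *-assoc y _ _ ⟩
      y * (p ⋆ 1# * (p ^ k) ⋆ 1#)   ≈⟨ *-congˡ (trans (sym (×1-homo-* p (p ^ k))) p^[1+k]≈0) ⟩
      y * 0#                        ≈⟨ zeroʳ y ⟩
      0#                            ∎)

-- Vectors and translations over a finite field.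

module FiniteAffineGroup {c ℓ₁ ℓ₂} (𝔽 : HeytingField c ℓ₁ ℓ₂) {q : ℕ}
                         (card : HasCardinality (fieldSetoid 𝔽) q) (n : ℕ) where
  open FiniteField 𝔽 card
  open CommutativeRing R
  open Enumeration {S = setoid} card
  open Matrices R n

  vectorGroup : AbelianGroup c ℓ₁
  vectorGroup = Pointwise.abelianGroup (Fin n) +-abelianGroup

  vector-cardinality : HasCardinality (AbelianGroup.setoid vectorGroup) (q ^ n)
  vector-cardinality = cardinality (AbelianGroup.setoid vectorGroup)
    (λ a j → element (finToFun a j))
    (λ {a} {b} eq → ≡.trans (≡.sym (Fin.funToFin-finToFin {n} {q} a))
      (≡.trans (funToFin-cong (λ j → element-injective (eq j))) (Fin.funToFin-finToFin {n} {q} b)))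
    (λ v → funToFin (index ∘ v) , λ j →
      trans (reflexive (≡.cong element (Fin.finToFun-funToFin (index ∘ v) j))) (element-index (v j)))
    where
    funToFin-cong : ∀ {n} {f g : Fin n → Fin q} → (∀ j → f j ≡ g j) → funToFin f ≡ funToFin g
    funToFin-cong {zero}  f≗g = ≡.refl
    funToFin-cong {suc n} f≗g = ≡.cong₂ Fin.combine (f≗g Fin.zero) (funToFin-cong (f≗g ∘ Fin.suc))

  vector-characteristic : ∀ p k → q ≡ p ^ k → ∀ v → MonoidMult._×_ (AbelianGroup.monoid vectorGroup) p v ≈ᵥ 0ᵥ
  vector-characteristic p k q≡p^k v j = trans (reflexive (×-lookup p)) (characteristic p k q≡p^k (v j))
    where
    ×-lookup : ∀ m → MonoidMult._×_ (AbelianGroup.monoid vectorGroup) m v j ≡ SemiringMult._×_ semiring m (v j)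
    ×-lookup zero    = ≡.refl
    ×-lookup (suc m) = ≡.cong (λ x → v j + x) (×-lookup m)

  open Affine
  private
    module V = AbelianGroup vectorGroup
    module M = Setoid matrixSetoid

  *ₘ-cancelʳ : ∀ {A B X} → IsInvertible X → A *ₘ X ≈ₘ B *ₘ X → A ≈ₘ B
  *ₘ-cancelʳ {A} {B} {X} (X⁻¹ , _ , XX⁻¹≈1) AX≈BX = begin
    A                  ≈⟨ cancel A ⟨
    A *ₘ X *ₘ X⁻¹      ≈⟨ *ₘ-cong {B = X⁻¹} AX≈BX M.refl ⟩
    B *ₘ X *ₘ X⁻¹      ≈⟨ cancel B ⟩
    B                  ∎
    where
    open SetoidReasoning matrixSetoid
    cancel : ∀ A → A *ₘ X *ₘ X⁻¹ ≈ₘ A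
    cancel A = M.trans (*ₘ-assoc A X X⁻¹) (M.trans (*ₘ-cong {A} M.refl XX⁻¹≈1) (*ₘ-identityʳ A))

  Translations : Pred Vec ℓ₁ → Pred Affine ℓ₁
  Translations P g = linear g ≈ₘ 1ₘ × translation g ∈ P

  translate : Vec → Affine
  translate v = record idₐ { translation = v }

  -- Conjugating the translation by `u` with the linear map `X` gives the translation by `X *ᵥ u`,
  -- here the quotient of `g` by `g′`. The identity is arranged so that no inverse has to be
  -- computed.
  conjugate : ∀ {g g′ X u} (X-inv : IsInvertible X) → linear g ≈ₘ 1ₘ → linear g′ ≈ₘ 1ₘ →
              X *ᵥ u ≈ᵥ translation g +ᵥ -ᵥ translation g′ →
              g ∘ₐ affine X X-inv 0ᵥ ≈ₐ g′ ∘ₐ affine X X-inv 0ᵥ ∘ₐ translate u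
  conjugate {affine A _ b} {affine A′ _ b′} {X} {u} _ A≈1 A′≈1 Xu≈b-b′ =
    M.trans (*ₘ-cong {B = X} (M.trans A≈1 (M.sym A′≈1)) M.refl) (M.sym (*ₘ-identityʳ (A′ *ₘ X))) ,ₐ
    (begin
      A *ᵥ 0ᵥ +ᵥ b                      ≈⟨ V.∙-congʳ {b} (*ᵥ-zeroʳ A) ⟩
      0ᵥ +ᵥ b                           ≈⟨ V.identityˡ b ⟩
      b                                 ≈⟨ GroupProperties.//-rightDividesˡ V.group b′ b ⟨
      b +ᵥ -ᵥ b′ +ᵥ b′                  ≈⟨ V.∙-cong {X *ᵥ u} {b +ᵥ -ᵥ b′} {0ᵥ +ᵥ b′} {b′} Xu≈b-b′ (V.identityˡ b′) ⟨
      X *ᵥ u +ᵥ (0ᵥ +ᵥ b′)              ≈⟨ V.∙-cong {(A′ *ₘ X) *ᵥ u} {X *ᵥ u} {A′ *ᵥ 0ᵥ +ᵥ b′} {0ᵥ +ᵥ b′}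
                                             (*ᵥ-cong {A′ *ₘ X} {X} {u} A′X≈X V.refl) (V.∙-congʳ {b′} (*ᵥ-zeroʳ A′)) ⟨
      (A′ *ₘ X) *ᵥ u +ᵥ (A′ *ᵥ 0ᵥ +ᵥ b′) ∎)
    where
    open SetoidReasoning V.setoid
    A′X≈X : A′ *ₘ X ≈ₘ X
    A′X≈X = M.trans (*ₘ-cong {B = X} A′≈1 M.refl) (*ₘ-identityˡ X)

  translations-cardinality : ∀ {P m} (e : Fin m → Vec) → (∀ {i j} → e i ≈ᵥ e j → i ≡ j) →
    (∀ i → e i ∈ P) → (∀ {v} → v ∈ P → ∃[ i ] e i ≈ᵥ v) →
    SubsetHasCardinality affineSetoid (Translations P) m
  translations-cardinality e e-injective e∈P e-surjective = cardinality _
    (λ i → translate (e i) , M.refl {1ₘ} , e∈P i)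
    (λ eq → e-injective (_≈ₐ_.translation-≈ eq))
    (λ (_ , g≈1 , b∈P) → let i , eᵢ≈b = e-surjective b∈P in i , (M.sym g≈1 ,ₐ eᵢ≈b))

  -- The intersection density of a group of translations.

  module _ {m} (W : AbelianGroupLemmas.FiniteSubgroup vectorGroup m) where
    open AbelianGroupLemmas.FiniteSubgroup W

    H : Pred Affine ℓ₁
    H = Translations Member

    H-cardinality : SubsetHasCardinality affineSetoid H m
    H-cardinality = translations-cardinality member member-injective (λ i → i , V.refl)
      (λ (i , v≈) → i , V.sym v≈)

    H-subgroup : IsSubgroup affineGroup H
    H-subgroup = record
      { resp      = λ (A≈ ,ₐ b≈) (A≈1 , b∈) → M.trans (M.sym A≈) A≈1 , resp b≈ b∈
      ; ε-closed  = M.refl {1ₘ} , ε-closed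
      ; ∙-closed  = λ {x} {y} (A≈1 , b∈) (A′≈1 , b′∈) →
          M.trans (*ₘ-cong A≈1 A′≈1) (*ₘ-identityˡ 1ₘ) ,
          resp (V.∙-congʳ (V.sym (V.trans (*ᵥ-cong A≈1 V.refl) (*ᵥ-identity (translation y))))) (∙-closed b′∈ b∈)
      ; ⁻¹-closed = λ {x} (A≈1 , b∈) →
          -- With A the linear part of `x`, A⁻¹ = A⁻¹ 1 = A⁻¹ A = 1.
          let A⁻¹≈1 = M.trans (M.sym (*ₘ-identityʳ (inverse x)))
                        (M.trans (*ₘ-cong {inverse x} M.refl (M.sym A≈1)) (proj₁ (proj₂ (invertible x)))) in
          A⁻¹≈1 , resp (V.sym (V.trans (*ᵥ-cong A⁻¹≈1 V.refl) (*ᵥ-identity (-ᵥ translation x)))) (⁻¹-closed b∈)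
      }

    -- Equality of the cosets puts `g ∘ₐ x` into that of `g′ ∘ₐ x`. Elements of `H` have linear part
    -- `1ₘ`, so comparing linear parts and cancelling that of `x` suffices.
    intersecting⇒linear-≈ : ∀ {F} → IsIntersecting affineGroup H F →
                            ∀ {g g′} → g ∈ F → g′ ∈ F → linear g ≈ₘ linear g′
    intersecting⇒linear-≈ F-intersecting {g} {g′} g∈F g′∈F =
      let x , gxH⊆g′xH , _ = F-intersecting g∈F g′∈F
          h , (h≈1 , _) , gx≈g′xh = gxH⊆g′xH (∈-leftCoset affineGroup H-subgroup (g ∘ₐ x))
      in *ₘ-cancelʳ {linear g} {linear g′} (invertible x) (M.trans (_≈ₐ_.linear-≈ gx≈g′xh)
           (M.trans (*ₘ-cong {linear g′ *ₘ linear x} M.refl h≈1) (*ₘ-identityʳ (linear g′ *ₘ linear x))))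

    -- All elements of `F` share one linear part, so each is determined by its translation vector,
    -- one of `q ^ n`.
    intersecting⇒≤ : ∀ {F f} → IsIntersecting affineGroup H F →
                     SubsetHasCardinality affineSetoid F f → f ≤ q ^ n
    intersecting⇒≤ {F} {f} F-intersecting F-card =
      Fin.injective⇒≤ {f = λ i → E.index (translation (proj₁ (F.element i)))} λ {i} {j} eq →
        F.element-injective
          (intersecting⇒linear-≈ F-intersecting (proj₂ (F.element i)) (proj₂ (F.element j)) ,ₐ
           E.index-injective eq)
      where
      module E = Enumeration {S = V.setoid} vector-cardinality
      module F = Enumeration F-card

    T : Pred Affine ℓ₁
    T = Translations (λ _ → ⊤)

    T-cardinality : SubsetHasCardinality affineSetoid T (q ^ n)
    T-cardinality = translations-cardinality E.element E.element-injective _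
      (λ {v} _ → E.index v , E.element-index v)
      where module E = Enumeration {S = V.setoid} vector-cardinality

    T-resp : ∀ {x y} → x ≈ₐ y → x ∈ T → y ∈ T
    T-resp (A≈ ,ₐ _) (A≈1 , _) = M.trans (M.sym A≈) A≈1 , _

    module _ (1<m : 1 < m) where

      -- By injectivity, the members numbered 0 and 1 cannot both be zero.
      nonzero-member : ∃[ i ] ¬ (member i ≈ᵥ 0ᵥ)
      nonzero-member with E._≈?_ (member 0F) 0ᵥ
        where
        module E = Enumeration {S = V.setoid} vector-cardinality
        0F = fromℕ< (ℕ.<-trans ℕ.z<s 1<m)
      ... | no  m₀≉0 = _ , m₀≉0
      ... | yes m₀≈0 = fromℕ< 1<m , λ m₁≈0 → ℕ.0≢1+n (Fin.fromℕ<-injective _ _ _ _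
              (member-injective (V.trans m₀≈0 (V.sym m₁≈0))))

      -- A nonzero `w` is reached from a nonzero member by transitivity; the zero vector forms an
      -- orbit of its own and is reached from `0ᵥ`.
      member-transporter : ∀ w → ∃[ A ] IsInvertible A × ∃[ u ] u ∈ Member × A *ᵥ u ≈ᵥ w
      member-transporter w with Enumeration._≈?_ {S = V.setoid} vector-cardinality w 0ᵥ
      ... | yes w≈0 = 1ₘ , invertible idₐ , 0ᵥ , ε-closed , V.trans (*ᵥ-identity 0ᵥ) (V.sym w≈0)
      ... | no  w≉0 =
        let i , mᵢ≉0 = nonzero-member
            A , A-inv , Au≈w = MatrixLemmas.transporter R n zero-or-unit mᵢ≉0 w≉0
        in A , A-inv , member i , (i , V.refl) , Au≈w

      -- The witness `x` is a linear map carrying some `u` in `W` to the difference of the two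
      -- translation vectors; then `g ∘ₐ x` and `g′ ∘ₐ x` differ on the right by the translation by
      -- `u`, an element of `H`.
      T-intersecting : IsIntersecting affineGroup H T
      T-intersecting {g} {g′} (A≈1 , _) (A′≈1 , _) =
        let X , X-inv , u , u∈ , Xu≈b-b′ = member-transporter (translation g +ᵥ -ᵥ translation g′)
            x = affine X X-inv 0ᵥ
        in x , leftCoset-≐ affineGroup H-subgroup {g ∘ₐ x} {g′ ∘ₐ x} {translate u} (M.refl {1ₘ} , u∈)
                 (conjugate {g} {g′} X-inv A≈1 A′≈1 Xu≈b-b′)

      density : ∀ r → q ^ n ≡ r ℕ.* m → IsIntersectionDensity affineGroup H (+ r / 1)
      density r q^n≡r*m =
        (T , T-resp , T-intersecting , q ^ n , T-cardinality , m , H-cardinality , m≢0 ,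
         /1≡/ (q ^ n) m r {{m≢0}} q^n≡r*m) ,
        -- A competing ratio brings its own count `h` of `H`, which must first be identified with
        -- `m`.
        λ { _ (F , _ , F-intersecting , f , F-card , h , H-card , h≢0 , ≡.refl) →
            /≤/1 f h r {{h≢0}} (≡.subst (f ≤_) (≡.trans q^n≡r*m (≡.cong (r ℕ.*_)
              (cardinality-unique _ H-cardinality H-card))) (intersecting⇒≤ F-intersecting F-card)) }
        where
        m≢0 : NonZero m
        m≢0 = ℕ.>-nonZero (ℕ.<-trans ℕ.z<s 1<m)

open import Data.Nat.Base using (_*_)

theorem1p2 : ∀ {c ℓ₁ ℓ₂} (p k n : ℕ) → Prime p → 1 ≤ k → 1 ≤ n →
    (𝔽 : HeytingField c ℓ₁ ℓ₂) → HasCardinality (fieldSetoid 𝔽) (p ^ k) →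
    (i : ℕ) → 1 ≤ i → i ≤ k * n →
    (+ (p ^ (k * n ∸ i)) / 1) ∈ IntersectionSpectrum (AGL n 𝔽)
theorem1p2 p k n p-prime _ _ 𝔽 card i 1≤i i≤kn =
  H W , H-subgroup W , density W 1<p^i (p ^ (k * n ∸ i))
    (begin
      (p ^ k) ^ n                          ≡⟨ ℕ.^-*-assoc p k n ⟩
      p ^ (k * n)                          ≡⟨ ≡.cong (p ^_) (ℕ.m∸n+n≡m i≤kn) ⟨
      p ^ (k * n ∸ i ℕ.+ i)                ≡⟨ ℕ.^-distribˡ-+-* p (k * n ∸ i) i ⟩
      p ^ (k * n ∸ i) * p ^ i              ∎)
  where
  open ≡.≡-Reasoning
  open FiniteAffineGroup 𝔽 card n
  open AbelianGroupLemmas vectorGroup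
  instance
    p≢0 : NonZero p
    p≢0 = prime⇒nonZero p-prime

  -- Here `1 ≤ i` enters: `W` must contain a nonzero vector for conjugates of `H` to reach every
  -- translation.
  1<p^i : 1 < p ^ i
  1<p^i = ℕ.^-monoʳ-< p (ℕ.nonTrivial⇒n>1 p {{prime⇒nonTrivial p-prime}}) 1≤i

  W : FiniteSubgroup (p ^ i)
  W = subgroup-of-order-^ p-prime (vector-characteristic p k ≡.refl)
        (≡.subst (HasCardinality _) (ℕ.^-*-assoc p k n) vector-cardinality) i i≤kn
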